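{- Let $\mathbf I=\langle I,\vee\rangle$ be a join-semilattice with order $\preceq$ (strict part $\prec$), let $\{\langle A_p,\le_p\rangle: p\in I\}$ be pairwise disjoint posets, and for $p\preceq q$ let $\psi_{pq},\varphi_{pq}:A_p\to A_q$ be monotone maps with $\varphi_{pp}=\psi_{pp}=\mathrm{id}_{A_p}$, $\varphi_{qr}\circ\varphi_{pq}=\varphi_{pr}$ and $\psi_{qr}\circ\psi_{pq}=\psi_{pr}$ for $p\preceq q\preceq r$. On $A:=\biguplus_pA_p$ define $a\le b$ (for $a\in A_p$, $b\in A_q$) iff $\varphi_{ps}(a)\le_s\psi_{qs}(b)$ where $s:=p\vee q$. Then $\le$ is a partial order on $A$ with $\le\cap A_p^2=\le_p$ for every $p\in I$ if and only if the following two conditions hold: (S1) whenever $p\prec q$, $p\prec r$ and $t:=q\vee r$, we have $\varphi_{qt}(\psi_{pq}(a))\le_t\psi_{rt}(\varphi_{pr}(a))$ for all $a\in A_p$; (S2) whenever $p\prec q$, $a,b\in A_p$ and $\varphi_{pq}(a)\le_q\psi_{pq}(b)$, then $a<_pb$. -}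

module Defs where

open import Level using (Level; _⊔_; suc)
open import Algebra.Core using (Op₂)
open import Data.Product using (Σ; _×_; _,_; proj₁)
open import Function.Bundles using (_⇔_)
open import Relation.Binary.Core using (Rel)
open import Relation.Binary.Definitions using (Monotonic₁)
open import Relation.Binary.Structures using (IsPartialOrder)
open import Relation.Binary.Lattice.Structures using (IsJoinSemilattice)
open import Relation.Binary.PropositionalEquality using (_≡_)
import Relation.Binary.Construct.NonStrictToStrict as NonStrictToStrict

-- A family of monotone maps f_{pq} : A_p → A_q for p ⪯ q.  Since the laws
-- are required for all proofs of the inequalities involved, f_{pq} depends
-- only on p and q, not on the proof of p ⪯ q.
record DirectSystem {i j a ℓ : Level}
                    {I : Set i} (_⪯_ : Rel I j)
                    (A : I → Set a) (_≤_ : ∀ {p} → Rel (A p) ℓ)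
                    : Set (i ⊔ j ⊔ a ⊔ ℓ) where
  field
    map      : ∀ {p q} → p ⪯ q → A p → A q
    monotone : ∀ {p q} (p⪯q : p ⪯ q) →
               Monotonic₁ (_≤_ {p}) (_≤_ {q}) (map p⪯q)
    identity : ∀ {p} (p⪯p : p ⪯ p) (x : A p) → map p⪯p x ≡ x
    compose  : ∀ {p q r} (p⪯q : p ⪯ q) (q⪯r : q ⪯ r) (p⪯r : p ⪯ r) (x : A p) →
               map q⪯r (map p⪯q x) ≡ map p⪯r x

record SemilatticeOfPosets (i j a ℓ : Level) : Set (suc (i ⊔ j ⊔ a ⊔ ℓ)) where
  infix 4 _⪯_ _≺_ _≤_ _<_ _⊑_
  infixr 6 _∨_
  field
    I                 : Set i
    _⪯_               : Rel I j
    _∨_               : Op₂ I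
    isJoinSemilattice : IsJoinSemilattice _≡_ _⪯_ _∨_
    A                 : I → Set a
    _≤_               : ∀ {p} → Rel (A p) ℓ
    isPoset           : ∀ p → IsPartialOrder _≡_ (_≤_ {p})
    φ-system          : DirectSystem _⪯_ A _≤_
    ψ-system          : DirectSystem _⪯_ A _≤_

  open IsJoinSemilattice isJoinSemilattice public using (x≤x∨y; y≤x∨y)
  open DirectSystem φ-system public using () renaming (map to φ)
  open DirectSystem ψ-system public using () renaming (map to ψ)

  _≺_ : Rel I (i ⊔ j)
  _≺_ = NonStrictToStrict._<_ _≡_ _⪯_

  _<_ : ∀ {p} → Rel (A p) (a ⊔ ℓ)
  _<_ {p} = NonStrictToStrict._<_ _≡_ (_≤_ {p})

  -- The disjoint union of the A_p; pairing each element with its index makes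
  -- the summands disjoint.
  ⨄A : Set (i ⊔ a)
  ⨄A = Σ I A

  _⊑_ : Rel ⨄A ℓ
  (p , x) ⊑ (q , y) = φ (x≤x∨y p q) x ≤ ψ (y≤x∨y p q) y

  ⊑-Restricts : Set (i ⊔ a ⊔ ℓ)
  ⊑-Restricts = ∀ p (x y : A p) → ((p , x) ⊑ (p , y)) ⇔ (x ≤ y)

  S1 : Set (i ⊔ j ⊔ a ⊔ ℓ)
  S1 = ∀ {p q r} (p≺q : p ≺ q) (p≺r : p ≺ r) (x : A p) →
       φ (x≤x∨y q r) (ψ (proj₁ p≺q) x) ≤ ψ (y≤x∨y q r) (φ (proj₁ p≺r) x)

  S2 : Set (i ⊔ j ⊔ a ⊔ ℓ)
  S2 = ∀ {p q} (p≺q : p ≺ q) (x y : A p) →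
       φ (proj₁ p≺q) x ≤ ψ (proj₁ p≺q) y → x < y

{-# OPTIONS --safe #-}
-- ψ_pq(a) ⊑ a ⊑ φ_pr(a) always holds, and (S1) is the composite
-- ψ_pq(a) ⊑ φ_pr(a); so transitivity forces (S1), while restriction and
-- antisymmetry force (S2).  Conversely, a ⊑ b ⊑ c can be compared in
-- t = (p ∨ q) ∨ (q ∨ r): (S1) bridges the two inequalities at b, and (S2)
-- reflects the resulting inequality from A_t down to A_{p ∨ r}.
-- Antisymmetry holds because a ⊑ b ⊑ a with a ∈ A_p and p ≺ p ∨ q would give
-- φ(a) ≤ ψ(a) in A_{p ∨ q}, hence a < a by (S2).
module Submission where

open import Defs
open import Axiom.ExcludedMiddle using (ExcludedMiddle)
open import Data.Empty using (⊥-elim)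
open import Data.Product using (_×_; _,_; proj₁; proj₂)
open import Function.Bundles using (_⇔_; mk⇔; Equivalence)
open import Level using (Level)
open import Relation.Binary.Core using (Rel)
open import Relation.Binary.Definitions
  using (Antisymmetric; DecidableEquality; Reflexive; Transitive)
open import Relation.Binary.Lattice.Structures using (IsJoinSemilattice)
open import Relation.Binary.Structures using (IsPartialOrder)
open import Relation.Binary.PropositionalEquality
  using (_≡_; refl; sym; trans; cong; subst; subst₂; isEquivalence)
open import Relation.Nullary using (yes; no)

-- `compose` accepts any proof for the composite, so `u` followed by an identity map may be read as
-- `v`.
map-irrelevant : ∀ {i j a ℓ} {I : Set i} {_⪯_ : Rel I j} {A : I → Set a}
                 {_≤_ : ∀ {p} → Rel (A p) ℓ} (D : DirectSystem _⪯_ A _≤_) →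
                 Reflexive _⪯_ → let open DirectSystem D in
                 ∀ {p q} (u v : p ⪯ q) (x : A p) → map u x ≡ map v x
map-irrelevant D ⪯-refl u v x =
  trans (sym (identity ⪯-refl (map u x))) (compose u ⪯-refl v x)
  where open DirectSystem D

module _ {i j a ℓ : Level} (S : SemilatticeOfPosets i j a ℓ) where
  open SemilatticeOfPosets S
  open IsJoinSemilattice isJoinSemilattice using (∨-least)
    renaming (refl to ⪯-refl; trans to ⪯-trans; antisym to ⪯-antisym)
  private
    module Φ = DirectSystem φ-system
    module Ψ = DirectSystem ψ-system
    module P {p} = IsPartialOrder (isPoset p)

  x≡x∨y : ∀ {p q} → q ⪯ p → p ≡ p ∨ q
  x≡x∨y q⪯p = ⪯-antisym (x≤x∨y _ _) (∨-least ⪯-refl q⪯p)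

  y≡x∨y : ∀ {p q} → p ⪯ q → q ≡ p ∨ q
  y≡x∨y p⪯q = ⪯-antisym (y≤x∨y _ _) (∨-least p⪯q ⪯-refl)

  -- Keeping `s` a variable allows matching on `refl`, so the comparison can be made at any index
  -- equal to the join, such as `p`, `q` or `q ∨ p`.
  ⊑-at-join : ∀ {p q s} → s ≡ p ∨ q → (p⪯s : p ⪯ s) (q⪯s : q ⪯ s) {x : A p} {y : A q} →
              ((p , x) ⊑ (q , y)) ⇔ (φ p⪯s x ≤ ψ q⪯s y)
  ⊑-at-join refl p⪯s q⪯s = mk⇔
    (subst₂ _≤_ (φ-irr _ p⪯s _) (ψ-irr _ q⪯s _))
    (subst₂ _≤_ (φ-irr p⪯s _ _) (ψ-irr q⪯s _ _))
    where
    φ-irr = map-irrelevant φ-system ⪯-refl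
    ψ-irr = map-irrelevant ψ-system ⪯-refl

  ⊑-restricts : ⊑-Restricts
  ⊑-restricts p x y = mk⇔
    (λ x⊑y → subst₂ _≤_ (Φ.identity ⪯-refl x) (Ψ.identity ⪯-refl y) (at-p.to x⊑y))
    (λ x≤y → at-p.from (subst₂ _≤_ (sym (Φ.identity ⪯-refl x)) (sym (Ψ.identity ⪯-refl y)) x≤y))
    where module at-p = Equivalence (⊑-at-join (x≡x∨y ⪯-refl) ⪯-refl ⪯-refl)

  x⊑φx : ∀ {p q} (p⪯q : p ⪯ q) (x : A p) → (p , x) ⊑ (q , φ p⪯q x)
  x⊑φx p⪯q x = Equivalence.from (⊑-at-join (y≡x∨y p⪯q) p⪯q ⪯-refl)
    (P.reflexive (sym (Ψ.identity ⪯-refl _)))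

  ψx⊑x : ∀ {p q} (p⪯q : p ⪯ q) (x : A p) → (q , ψ p⪯q x) ⊑ (p , x)
  ψx⊑x p⪯q x = Equivalence.from (⊑-at-join (x≡x∨y p⪯q) ⪯-refl p⪯q)
    (P.reflexive (Φ.identity ⪯-refl _))

  ⊑-partialOrder⇒S1 : IsPartialOrder _≡_ _⊑_ → S1
  ⊑-partialOrder⇒S1 po (p⪯q , _) (p⪯r , _) x =
    IsPartialOrder.trans po {j = _ , x} (ψx⊑x p⪯q x) (x⊑φx p⪯r x)

  ⊑-partialOrder⇒S2 : IsPartialOrder _≡_ _⊑_ → S2
  ⊑-partialOrder⇒S2 po {p} {q} (p⪯q , p≢q) x y φx≤ψy = x≤y , x≢y
    where
    module ⊑ = IsPartialOrder po

    x⊑ψ : ∀ {z} → φ p⪯q x ≤ ψ p⪯q z → (p , x) ⊑ (q , ψ p⪯q z)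
    x⊑ψ φx≤ψz = Equivalence.from (⊑-at-join (y≡x∨y p⪯q) p⪯q ⪯-refl)
      (P.trans φx≤ψz (P.reflexive (sym (Ψ.identity ⪯-refl _))))

    x≤y : x ≤ y
    x≤y = Equivalence.to (⊑-restricts p x y)
      -- The link from `x` to `y` is `ψ p⪯q y`: the hypothesis puts `x` below it, and it always lies
      -- below `y`.
      (⊑.trans {j = q , ψ p⪯q y} (x⊑ψ φx≤ψy) (ψx⊑x p⪯q y))

    x≢y : x ≡ y → _
    -- If `y` is `x`, then `x` and `ψ p⪯q x` lie below each other, so antisymmetry identifies their
    -- indices.
    x≢y refl = p≢q (cong proj₁
      (⊑.antisym {i = p , x} {j = q , ψ p⪯q x} (x⊑ψ φx≤ψy) (ψx⊑x p⪯q x)))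

  module _ (_≟_ : DecidableEquality I) (s1 : S1) (s2 : S2) where

    -- Extends (S1) from `≺` to `⪯`: when `p` equals `q` or `r`, one of the maps is the identity and
    -- `x⊑φx` or `ψx⊑x` applies.
    ψx⊑φx : ∀ {p q r} (p⪯q : p ⪯ q) (p⪯r : p ⪯ r) (x : A p) →
            (q , ψ p⪯q x) ⊑ (r , φ p⪯r x)
    ψx⊑φx {p} {q} {r} p⪯q p⪯r x with p ≟ q | p ≟ r
    ... | yes refl | _        = subst (λ z → (p , z) ⊑ (r , φ p⪯r x))
                                  (sym (Ψ.identity p⪯q x)) (x⊑φx p⪯r x)
    ... | no _     | yes refl = subst (λ z → (q , ψ p⪯q x) ⊑ (p , z))
                                  (sym (Φ.identity p⪯r x)) (ψx⊑x p⪯q x)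
    ... | no p≢q   | no p≢r   = s1 (p⪯q , p≢q) (p⪯r , p≢r) x

    ψx≤φx : ∀ {p q} (p⪯q : p ⪯ q) (x : A p) → ψ p⪯q x ≤ φ p⪯q x
    ψx≤φx p⪯q x = Equivalence.to (⊑-restricts _ _ _) (ψx⊑φx p⪯q p⪯q x)

    φ≤ψ⇒≤ : ∀ {p q} (p⪯q : p ⪯ q) {x y : A p} → φ p⪯q x ≤ ψ p⪯q y → x ≤ y
    φ≤ψ⇒≤ {p} {q} p⪯q {x} {y} φx≤ψy with p ≟ q
    ... | yes refl = subst₂ _≤_ (Φ.identity p⪯q x) (Ψ.identity p⪯q y) φx≤ψy
    ... | no p≢q   = proj₁ (s2 (p⪯q , p≢q) x y φx≤ψy)

    φx≤ψx⇒≡ : ∀ {p q} (p⪯q : p ⪯ q) {x : A p} → φ p⪯q x ≤ ψ p⪯q x → p ≡ q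
    φx≤ψx⇒≡ {p} {q} p⪯q {x} φx≤ψx with p ≟ q
    ... | yes p≡q = p≡q
    ... | no p≢q  = ⊥-elim (proj₂ (s2 (p⪯q , p≢q) x x φx≤ψx) refl)

    ⊑-reflexive : ∀ {u v} → u ≡ v → u ⊑ v
    ⊑-reflexive {p , x} refl = Equivalence.from (⊑-restricts p x x) P.refl

    ⊑-trans : Transitive _⊑_
    ⊑-trans {p , x} {q , y} {r , z} x⊑y y⊑z = φ≤ψ⇒≤ w⪯t φφx≤ψψz
      where
      u⪯t = x≤x∨y (p ∨ q) (q ∨ r)
      v⪯t = y≤x∨y (p ∨ q) (q ∨ r)
      p⪯t = ⪯-trans (x≤x∨y p q) u⪯t
      r⪯t = ⪯-trans (y≤x∨y q r) v⪯t
      w⪯t = ∨-least p⪯t r⪯t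

      φx≤ψz : φ p⪯t x ≤ ψ r⪯t z
      -- In `A t` the chain is `φ x ≤ φ (ψ y) ≤ ψ (φ y) ≤ ψ z`. Its middle step is `ψx⊑φx` unfolded,
      -- since `t` is by definition the join of `p ∨ q` and `q ∨ r`.
      φx≤ψz = subst₂ _≤_ (Φ.compose _ _ p⪯t x) (Ψ.compose _ _ r⪯t z)
        (P.trans (Φ.monotone u⪯t x⊑y)
          (P.trans (ψx⊑φx (y≤x∨y p q) (x≤x∨y q r) y) (Ψ.monotone v⪯t y⊑z)))

      φφx≤ψψz : φ w⪯t (φ (x≤x∨y p r) x) ≤ ψ w⪯t (ψ (y≤x∨y p r) z)
      φφx≤ψψz = subst₂ _≤_ (sym (Φ.compose _ _ p⪯t x)) (sym (Ψ.compose _ _ r⪯t z)) φx≤ψz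

    ⊑-antisym : Antisymmetric _≡_ _⊑_
    ⊑-antisym {p , x} {q , y} x⊑y y⊑x = equal (trans p≡s (sym q≡s)) x⊑y y⊑x
      where
      p⪯s = x≤x∨y p q
      q⪯s = y≤x∨y p q

      φy≤ψx : φ q⪯s y ≤ ψ p⪯s x
      -- `y⊑x` is an inequality at `q ∨ p`; commutativity of the join moves it to `p ∨ q`.
      φy≤ψx = Equivalence.to
        (⊑-at-join (⪯-antisym (∨-least (y≤x∨y q p) (x≤x∨y q p)) (∨-least q⪯s p⪯s)) q⪯s p⪯s) y⊑x

      p≡s : p ≡ p ∨ q
      -- The round trip in `A (p ∨ q)` is `φ x ≤ ψ y ≤ φ y ≤ ψ x`.
      p≡s = φx≤ψx⇒≡ p⪯s (P.trans x⊑y (P.trans (ψx≤φx q⪯s y) φy≤ψx))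

      q≡s : q ≡ p ∨ q
      q≡s = φx≤ψx⇒≡ q⪯s (P.trans φy≤ψx (P.trans (ψx≤φx p⪯s x) x⊑y))

      -- Generic indices let `p ≡ q` be matched with `refl`, which reduces the claim to antisymmetry
      -- in a single `A p`.
      equal : ∀ {p q} {x : A p} {y : A q} → p ≡ q →
              (p , x) ⊑ (q , y) → (q , y) ⊑ (p , x) → _≡_ {A = ⨄A} (p , x) (q , y)
      equal {p} refl x⊑y y⊑x = cong (p ,_)
        (P.antisym (Equivalence.to (⊑-restricts p _ _) x⊑y)
                   (Equivalence.to (⊑-restricts p _ _) y⊑x))

    ⊑-isPartialOrder : IsPartialOrder _≡_ _⊑_
    ⊑-isPartialOrder = record
      { isPreorder = record
        { isEquivalence = isEquivalence
        ; reflexive     = ⊑-reflexive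
        ; trans         = λ {u v w} → ⊑-trans {u} {v} {w}
        }
      ; antisym = ⊑-antisym
      }

theorem5p1 : ∀ {i j a ℓ} → ExcludedMiddle i →
    (S : SemilatticeOfPosets i j a ℓ) →
    let open SemilatticeOfPosets S in
    (IsPartialOrder _≡_ _⊑_ × ⊑-Restricts) ⇔ (S1 × S2)
theorem5p1 em S = mk⇔
  (λ (po , _) → ⊑-partialOrder⇒S1 S po , ⊑-partialOrder⇒S2 S po)
  -- Excluded middle decides equality in `I`, which splits `p ⪯ q` into `p ≡ q` and `p ≺ q`.
  (λ (s1 , s2) → ⊑-isPartialOrder S (λ _ _ → em) s1 s2 , ⊑-restricts S)
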